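{- For all $n \ge 5$, \[ w(n,1) = w(n-2,1) + w(n-3,0) - 1, \] where $w(m,k)$ is the number of compositions of $m$ with all parts in $\{1,2\}$ having exactly $k$ water cells.
   Context: A composition of $n \ge 0$ is a finite sequence $(c_1,\dots,c_t)$ of positive integers with $c_1+\cdots+c_t=n$; the empty composition is the unique composition of $0$. Let $C_{12}(n)$ be the set of compositions of $n$ all of whose parts lie in $\{1,2\}$. The number of water cells of a composition $(c_1,\dots,c_t)$ is $\sum_{i=1}^{t} \max\bigl(0, \min(\max_{j \le i} c_j, \max_{j \ge i} c_j) - c_i\bigr)$ (the number of unit squares that would hold water poured over its bargraph, in which column $i$ has height $c_i$). For $n,k \ge 0$, $W(n,k)$ is the set of compositions in $C_{12}(n)$ with exactly $k$ water cells and $w(n,k)=|W(n,k)|$. -}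

module Defs where

open import Data.Empty using (⊥)
open import Data.List.Base using (List; []; _∷_; [_]; _++_; map; filter; length; lookup; take; drop; tabulate)
open import Data.List.Extrema.Nat using (max)
open import Data.List.Membership.Propositional using (_∈_)
open import Data.List.Membership.Propositional.Properties
  using (∈-map⁺; ∈-map⁻; ∈-++⁺ˡ; ∈-++⁺ʳ; ∈-++⁻; ∈-filter⁺; ∈-filter⁻)
open import Data.List.Properties using (∷-injectiveʳ)
open import Data.List.Relation.Unary.All using (All; []; _∷_)
open import Data.List.Relation.Unary.AllPairs using ([]; _∷_)
open import Data.List.Relation.Unary.Any using (here; there)
open import Data.List.Relation.Unary.Unique.Propositional using (Unique)
import Data.List.Relation.Unary.Unique.Propositional.Properties as Unique
open import Data.Fin.Base using (Fin; toℕ)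
open import Data.Nat.Base using (ℕ; zero; suc; _+_; _∸_; _⊓_; _<_; z≤n; s≤s)
open import Data.Nat.ListAction using (sum)
open import Data.Nat.Properties using (_≟_; suc-injective)
open import Data.Product.Base using (∃; _×_; _,_)
open import Data.Sum.Base using (_⊎_; inj₁; inj₂)
open import Function.Bundles using (_⇔_; mk⇔)
open import Level using (Level; _⊔_)
open import Relation.Binary.PropositionalEquality using (_≡_; refl; cong)
open import Relation.Unary using (Pred)

private
  variable
    a p : Level

IsComposition : ℕ → Pred (List ℕ) _
IsComposition n cs = All (0 <_) cs × sum cs ≡ n

C₁₂ : ℕ → Pred (List ℕ) _
C₁₂ n cs = IsComposition n cs × All (λ c → c ≡ 1 ⊎ c ≡ 2) cs

-- Truncated subtraction is the max(0, –) of the definition. Both maxima range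
-- over nonempty lists (each contains column i), so the default 0 plays no role.
waterAt : (cs : List ℕ) → Fin (length cs) → ℕ
waterAt cs i =
  (max 0 (take (suc (toℕ i)) cs) ⊓ max 0 (drop (toℕ i) cs)) ∸ lookup cs i

waterCells : List ℕ → ℕ
waterCells cs = sum (tabulate (waterAt cs))

W : ℕ → ℕ → Pred (List ℕ) _
W n k cs = C₁₂ n cs × waterCells cs ≡ k

-- A duplicate-free list of exactly the elements satisfying P; its length is
-- the cardinality of P, whichever such list is chosen.
record Enumeration {A : Set a} (P : Pred A p) : Set (a ⊔ p) where
  field
    elements : List A
    unique   : Unique elements
    exact    : ∀ x → x ∈ elements ⇔ P x

  card : ℕ
  card = length elements

c₁₂ : ℕ → List (List ℕ)
c₁₂ zero          = [ [] ]
c₁₂ (suc zero)    = [ [ 1 ] ]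
c₁₂ (suc (suc n)) = map (1 ∷_) (c₁₂ (suc n)) ++ map (2 ∷_) (c₁₂ n)

c₁₂-unique : ∀ n → Unique (c₁₂ n)
c₁₂-unique zero          = [] ∷ []
c₁₂-unique (suc zero)    = [] ∷ []
c₁₂-unique (suc (suc n)) =
  Unique.++⁺ (Unique.map⁺ ∷-injectiveʳ (c₁₂-unique (suc n)))
             (Unique.map⁺ ∷-injectiveʳ (c₁₂-unique n))
             λ (l , r) → disjoint (∈-map⁻ (1 ∷_) l) (∈-map⁻ (2 ∷_) r)
  where
  disjoint : ∀ {xs} {ys zs : List (List ℕ)} →
             ∃ (λ y → y ∈ ys × xs ≡ 1 ∷ y) → ∃ (λ z → z ∈ zs × xs ≡ 2 ∷ z) → ⊥
  disjoint (_ , _ , refl) (_ , _ , ())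

c₁₂-sound : ∀ n {cs} → cs ∈ c₁₂ n → C₁₂ n cs
c₁₂-sound zero       (here refl) = ([] , refl) , []
c₁₂-sound (suc zero) (here refl) = (s≤s z≤n ∷ [] , refl) , inj₁ refl ∷ []
c₁₂-sound (suc (suc n)) cs∈ with ∈-++⁻ (map (1 ∷_) (c₁₂ (suc n))) cs∈
... | inj₁ l with _ , ds∈ , refl ← ∈-map⁻ (1 ∷_) l
             with (pos , eq) , parts ← c₁₂-sound (suc n) ds∈
             = (s≤s z≤n ∷ pos , cong suc eq) , inj₁ refl ∷ parts
... | inj₂ r with _ , ds∈ , refl ← ∈-map⁻ (2 ∷_) r
             with (pos , eq) , parts ← c₁₂-sound n ds∈
             = (s≤s z≤n ∷ pos , cong (2 +_) eq) , inj₂ refl ∷ parts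

c₁₂-complete : ∀ n cs → C₁₂ n cs → cs ∈ c₁₂ n
c₁₂-complete zero [] _ = here refl
c₁₂-complete zero (_ ∷ _) ((s≤s _ ∷ _ , ()) , _)
c₁₂-complete (suc _) [] ((_ , ()) , _)
c₁₂-complete (suc zero) (_ ∷ []) (_ , inj₁ refl ∷ _) = here refl
c₁₂-complete (suc zero) (_ ∷ _ ∷ _) ((_ ∷ s≤s _ ∷ _ , ()) , inj₁ refl ∷ _)
c₁₂-complete (suc zero) (_ ∷ _) ((_ , ()) , inj₂ refl ∷ _)
c₁₂-complete (suc (suc n)) (_ ∷ cs) ((_ ∷ pos , eq) , inj₁ refl ∷ parts) =
  ∈-++⁺ˡ (∈-map⁺ (1 ∷_) (c₁₂-complete (suc n) cs ((pos , suc-injective eq) , parts)))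
c₁₂-complete (suc (suc n)) (_ ∷ cs) ((_ ∷ pos , eq) , inj₂ refl ∷ parts) =
  ∈-++⁺ʳ (map (1 ∷_) (c₁₂ (suc n)))
    (∈-map⁺ (2 ∷_)
      (c₁₂-complete n cs ((pos , suc-injective (suc-injective eq)) , parts)))

W-enumeration : ∀ n k → Enumeration (W n k)
W-enumeration n k = record
  { elements = filter W? (c₁₂ n)
  ; unique   = Unique.filter⁺ W? (c₁₂-unique n)
  ; exact    = λ cs → mk⇔
      (λ cs∈ → let m , eq = ∈-filter⁻ W? {xs = c₁₂ n} cs∈ in c₁₂-sound n m , eq)
      (λ (c , eq) → ∈-filter⁺ W? (c₁₂-complete n cs c) eq)
  }
  where
  W? = λ cs → waterCells cs ≟ k

w : ℕ → ℕ → ℕ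
w n k = Enumeration.card (W-enumeration n k)

{-# OPTIONS --safe #-}
-- Prepending 1 to a composition adds no water, so splitting by the first part
-- gives w(n+2,k) = w(n+1,k) + T(n,k), where T(n,k) counts the compositions of n
-- that hold k cells behind a wall of height 2. Behind such a wall a leading 2
-- changes nothing, a leading 1,2 adds exactly one cell, and a leading 1,1 holds
-- either no water or at least two cells; hence T(n+4,1) = T(n+2,1) + T(n+1,0).
-- Summing this relation over n gives the theorem up to an additive constant, and
-- the case n = 5 fixes the constant.
module Submission where

open import Defs
open import Algebra.Properties.CommutativeSemigroup using (interchange)
open import Data.Bool.Base using (true; false)
open import Data.Empty using (⊥)
open import Data.Fin.Base using (Fin; toℕ)
open import Data.Integer.Base using (+_; _+_; _-_; 1ℤ)
open import Data.List.Base
  using (List; []; _∷_; _++_; map; filter; length; lookup; take; drop; tabulate)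
open import Data.List.Extrema.Nat using (max; max≤v⁺; v≤max⁺; xs≤max)
open import Data.List.Properties
  using (filter-++; filter-none; filter-≐; length-++; tabulate-cong)
open import Data.List.Relation.Unary.All as All using (All; []; _∷_)
open import Data.List.Relation.Unary.Any using (here; there)
open import Data.Nat.Base as ℕ using (ℕ; zero; suc; _≤_; _<_; _≡ᵇ_; _∸_; _⊔_; _⊓_; z≤n; s≤s)
open import Data.Nat.ListAction using (sum)
open import Data.Nat.Properties
open import Data.Product.Base using (_,_; proj₁)
open import Data.Sum.Base using (inj₂; [_,_]′)
open import Function.Base using (_∘_)
open import Relation.Binary.PropositionalEquality

private
  variable
    A B : Set
    c h L : ℕ
    cs : List ℕ

max-∷ : ∀ c cs → max 0 (c ∷ cs) ≡ c ⊔ max 0 cs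
max-∷ c cs = ≤-antisym
  (max≤v⁺ z≤n (m≤m⊔n c _ ∷ All.map (m≤n⇒m≤o⊔n c) (xs≤max 0 cs)))
  (⊔-lub (v≤max⁺ 0 (c ∷ cs) (inj₂ (here ≤-refl)))
         (max≤v⁺ z≤n (All.tail (xs≤max 0 (c ∷ cs)))))

-- The water over cs when a wall of height L stands immediately to its left.
flood : ℕ → List ℕ → ℕ
flood L []       = 0
flood L (c ∷ cs) = (((L ⊔ c) ⊓ max 0 (c ∷ cs)) ∸ c) ℕ.+ flood (L ⊔ c) cs

-- Generalises `waterAt` so that induction on the list goes through: columns already passed matter
-- only through their maximum `L`. At `L = 0` it computes to `waterAt`.
floodAt : ℕ → (cs : List ℕ) → Fin (length cs) → ℕ
floodAt L cs i =
  ((L ⊔ max 0 (take (suc (toℕ i)) cs)) ⊓ max 0 (drop (toℕ i) cs)) ∸ lookup cs i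

⊔-max-∷ : ∀ L c cs → L ⊔ max 0 (c ∷ cs) ≡ (L ⊔ c) ⊔ max 0 cs
⊔-max-∷ L c cs = trans (cong (L ⊔_) (max-∷ c cs)) (sym (⊔-assoc L c _))

sum-floodAt : ∀ L cs → sum (tabulate (floodAt L cs)) ≡ flood L cs
sum-floodAt L []       = refl
sum-floodAt L (c ∷ cs) = cong₂ ℕ._+_
  (cong (λ l → (l ⊓ max 0 (c ∷ cs)) ∸ c)
        (trans (⊔-max-∷ L c []) (⊔-identityʳ (L ⊔ c))))
  -- For a column of the tail, `c` is absorbed into the wall, which becomes `L ⊔ c`.
  (trans (cong sum (tabulate-cong λ i →
           cong (λ l → (l ⊓ max 0 (drop (toℕ i) cs)) ∸ lookup cs i)
                (⊔-max-∷ L c (take (suc (toℕ i)) cs))))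
         (sum-floodAt (L ⊔ c) cs))

waterCells≡flood : ∀ cs → waterCells cs ≡ flood 0 cs
waterCells≡flood = sum-floodAt 0

-- Column `c` attains its own left maximum, so it holds nothing and then serves as the wall.
flood-rise : ∀ cs → L ≤ c → flood L (c ∷ cs) ≡ flood c cs
flood-rise {L} {c} cs L≤c rewrite m≤n⇒m⊔n≡n L≤c =
  cong (ℕ._+ flood c cs) (m≤n⇒m∸n≡0 (m⊓n≤m c _))

-- Every right maximum is at most `h`, hence at most the column itself, so no wall on the left can
-- retain water.
flood-low : All (h ≤_) cs → max 0 cs ≤ h → ∀ L → flood L cs ≡ 0
flood-low                   []           _     L = refl
flood-low {h} {cs = c ∷ cs} (h≤c ∷ h≤cs) max≤h L = cong₂ ℕ._+_
  (m≤n⇒m∸n≡0 (≤-trans (m⊓n≤n (L ⊔ c) _) (≤-trans max≤h h≤c)))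
  (flood-low h≤cs (m⊔n≤o⇒n≤o c _ (subst (_≤ h) (max-∷ c cs) max≤h)) (L ⊔ c))

flood-cell : ∀ cs → 2 ≤ max 0 (1 ∷ cs) → flood 2 (1 ∷ cs) ≡ suc (flood 2 cs)
flood-cell cs 2≤max =
  cong (λ m → (m ∸ 1) ℕ.+ flood 2 cs) (m≤n⇒m⊓n≡m 2≤max)

waterCells-1∷ : All (0 <_) cs → waterCells (1 ∷ cs) ≡ waterCells cs
waterCells-1∷ {cs} pos = begin
  waterCells (1 ∷ cs) ≡⟨ waterCells≡flood (1 ∷ cs) ⟩
  flood 0 (1 ∷ cs)    ≡⟨ flood-rise cs z≤n ⟩
  flood 1 cs          ≡⟨ flood-1 pos ⟩
  flood 0 cs          ≡⟨ waterCells≡flood cs ⟨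
  waterCells cs       ∎
  where
  open ≡-Reasoning
  -- A positive first part is at least as high as a wall of height 0 or 1, so it replaces either
  -- one.
  flood-1 : ∀ {cs} → All (0 <_) cs → flood 1 cs ≡ flood 0 cs
  flood-1 []                    = refl
  flood-1 (_∷_ {xs = cs} 0<c _) = trans (flood-rise cs 0<c) (sym (flood-rise cs z≤n))

waterCells-2∷ : ∀ cs → waterCells (2 ∷ cs) ≡ flood 2 cs
waterCells-2∷ cs = trans (waterCells≡flood (2 ∷ cs)) (flood-rise cs z≤n)

flood-12∷ : ∀ cs → flood 2 (1 ∷ 2 ∷ cs) ≡ suc (flood 2 cs)
flood-12∷ cs = trans
  (flood-cell (2 ∷ cs) (All.lookup (xs≤max 0 (1 ∷ 2 ∷ cs)) (there (here refl))))
  (cong suc (flood-rise cs ≤-refl))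

-- Split on whether a part of at least 2 follows: without one there is no right bank and all is dry;
-- with one, each of the two leading 1s holds a cell.
flood-11∷ : All (0 <_) cs → flood 2 (1 ∷ 1 ∷ cs) ≢ 1
flood-11∷ {cs} pos eq = [ 0≢1 , 2+≢1 ]′ (≤-<-connex (max 0 (1 ∷ cs)) 1)
  where
  0≢1 : max 0 (1 ∷ cs) ≤ 1 → ⊥
  0≢1 max≤1 = 0≢1+n (trans (sym dry) eq)
    where
    dry : flood 2 (1 ∷ 1 ∷ cs) ≡ 0
    dry = flood-low (≤-refl ∷ ≤-refl ∷ pos)
      (subst (_≤ 1) (sym (max-∷ 1 (1 ∷ cs))) (⊔-lub ≤-refl max≤1)) 2
  2+≢1 : 2 ≤ max 0 (1 ∷ cs) → ⊥
  2+≢1 2≤max = 1+n≢0 (suc-injective (trans (sym wet) eq))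
    where
    wet : flood 2 (1 ∷ 1 ∷ cs) ≡ 2 ℕ.+ flood 2 cs
    wet = trans
      (flood-cell (1 ∷ cs) (subst (2 ≤_) (sym (max-∷ 1 (1 ∷ cs))) (m≤n⇒m≤o⊔n 1 2≤max)))
      (cong suc (flood-cell cs 2≤max))

-- `w n k` unfolds to `count waterCells k (c₁₂ n)`, so the lemmas on `count` apply to it directly.
count : (A → ℕ) → ℕ → List A → ℕ
count f k xs = length (filter (λ x → f x ≟ k) xs)

count-++ : ∀ (f : A → ℕ) k xs ys → count f k (xs ++ ys) ≡ count f k xs ℕ.+ count f k ys
count-++ f k xs ys = trans (cong length (filter-++ (λ x → f x ≟ k) xs ys))
                           (length-++ (filter (λ x → f x ≟ k) xs))

count-map : ∀ (f : B → ℕ) k (g : A → B) xs → count f k (map g xs) ≡ count (f ∘ g) k xs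
count-map f k g []       = refl
-- The Boolean inside `_≟_` is `_≡ᵇ_`, so splitting on it makes both filters reduce.
count-map f k g (x ∷ xs) with ih ← count-map f k g xs | f (g x) ≡ᵇ k
... | true  = cong suc ih
... | false = ih

count-cong : ∀ {f g : A → ℕ} k {xs} → All (λ x → f x ≡ g x) xs → count f k xs ≡ count g k xs
count-cong             k []             = refl
count-cong {f = f} {g} k (_∷_ {x} e es) rewrite e
  with ih ← count-cong {f = f} {g} k es | g x ≡ᵇ k
... | true  = cong suc ih
... | false = ih

count-suc : ∀ (f : A → ℕ) k xs → count (suc ∘ f) (suc k) xs ≡ count f k xs
count-suc f k xs = cong length (filter-≐ (λ x → suc (f x) ≟ suc k) (λ x → f x ≟ k)
                                         (suc-injective , cong suc) xs)

count-none : ∀ {f : A → ℕ} k {xs} → All (λ x → f x ≢ k) xs → count f k xs ≡ 0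
count-none k ≢k = cong length (filter-none (λ x → _ ≟ k) ≢k)

count-c₁₂ : ∀ f k n → count f k (c₁₂ (2 ℕ.+ n)) ≡
            count (f ∘ (1 ∷_)) k (c₁₂ (1 ℕ.+ n)) ℕ.+ count (f ∘ (2 ∷_)) k (c₁₂ n)
count-c₁₂ f k n = trans
  (count-++ f k (map (1 ∷_) (c₁₂ (1 ℕ.+ n))) (map (2 ∷_) (c₁₂ n)))
  (cong₂ ℕ._+_ (count-map f k (1 ∷_) (c₁₂ (1 ℕ.+ n))) (count-map f k (2 ∷_) (c₁₂ n)))

c₁₂-positive : ∀ n → All (All (0 <_)) (c₁₂ n)
c₁₂-positive n = All.tabulate (proj₁ ∘ proj₁ ∘ c₁₂-sound n)

walled : ℕ → ℕ → ℕ
walled n k = count (flood 2) k (c₁₂ n)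

w-recurrence : ∀ n k → w (2 ℕ.+ n) k ≡ w (1 ℕ.+ n) k ℕ.+ walled n k
w-recurrence n k = trans (count-c₁₂ waterCells k n) (cong₂ ℕ._+_
  (count-cong k (All.map waterCells-1∷ (c₁₂-positive (1 ℕ.+ n))))
  (count-cong k (All.universal waterCells-2∷ (c₁₂ n))))

walled-recurrence : ∀ n → walled (4 ℕ.+ n) 1 ≡ walled (2 ℕ.+ n) 1 ℕ.+ walled (1 ℕ.+ n) 0
walled-recurrence n = begin
  walled (4 ℕ.+ n) 1
    ≡⟨ count-c₁₂ (flood 2) 1 (2 ℕ.+ n) ⟩
  count (flood 2 ∘ (1 ∷_)) 1 (c₁₂ (3 ℕ.+ n)) ℕ.+ count (flood 2 ∘ (2 ∷_)) 1 (c₁₂ (2 ℕ.+ n))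
    ≡⟨ cong₂ ℕ._+_ lead-1
         (count-cong 1 (All.universal (λ cs → flood-rise cs ≤-refl) (c₁₂ (2 ℕ.+ n)))) ⟩
  walled (1 ℕ.+ n) 0 ℕ.+ walled (2 ℕ.+ n) 1
    ≡⟨ +-comm (walled (1 ℕ.+ n) 0) _ ⟩
  walled (2 ℕ.+ n) 1 ℕ.+ walled (1 ℕ.+ n) 0 ∎
  where
  open ≡-Reasoning
  -- Whether a leading 1 holds water depends on what follows, so the list is split by its second
  -- part too; only the case 1,2 survives.
  lead-1 : count (flood 2 ∘ (1 ∷_)) 1 (c₁₂ (3 ℕ.+ n)) ≡ walled (1 ℕ.+ n) 0
  lead-1 = begin
    count (flood 2 ∘ (1 ∷_)) 1 (c₁₂ (3 ℕ.+ n))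
      ≡⟨ count-c₁₂ (flood 2 ∘ (1 ∷_)) 1 (1 ℕ.+ n) ⟩
    count (flood 2 ∘ (1 ∷_) ∘ (1 ∷_)) 1 (c₁₂ (2 ℕ.+ n)) ℕ.+
    count (flood 2 ∘ (1 ∷_) ∘ (2 ∷_)) 1 (c₁₂ (1 ℕ.+ n))
      ≡⟨ cong₂ ℕ._+_ (count-none 1 (All.map flood-11∷ (c₁₂-positive (2 ℕ.+ n))))
                     (count-cong 1 (All.universal flood-12∷ (c₁₂ (1 ℕ.+ n)))) ⟩
    count (suc ∘ flood 2) 1 (c₁₂ (1 ℕ.+ n))
      ≡⟨ count-suc (flood 2) 0 (c₁₂ (1 ℕ.+ n)) ⟩
    walled (1 ℕ.+ n) 0 ∎

-- The successor stands for the subtracted 1 and keeps the induction within the naturals.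
w-one-cell : ∀ n → suc (w (5 ℕ.+ n) 1) ≡ w (3 ℕ.+ n) 1 ℕ.+ w (2 ℕ.+ n) 0
-- Here `w 5 1` is 1 (only 2,1,2), `w 3 1` is 0 and `w 2 0` is 2.
w-one-cell zero    = refl
w-one-cell (suc n) = begin
  suc (w (6 ℕ.+ n) 1)
    ≡⟨ cong suc (w-recurrence (4 ℕ.+ n) 1) ⟩
  suc (w (5 ℕ.+ n) 1) ℕ.+ walled (4 ℕ.+ n) 1
    ≡⟨ cong₂ ℕ._+_ (w-one-cell n) (walled-recurrence n) ⟩
  (w (3 ℕ.+ n) 1 ℕ.+ w (2 ℕ.+ n) 0) ℕ.+ (walled (2 ℕ.+ n) 1 ℕ.+ walled (1 ℕ.+ n) 0)
    ≡⟨ interchange +-commutativeSemigroup (w (3 ℕ.+ n) 1) (w (2 ℕ.+ n) 0) _ _ ⟩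
  (w (3 ℕ.+ n) 1 ℕ.+ walled (2 ℕ.+ n) 1) ℕ.+ (w (2 ℕ.+ n) 0 ℕ.+ walled (1 ℕ.+ n) 0)
    ≡⟨ cong₂ ℕ._+_ (w-recurrence (2 ℕ.+ n) 1) (w-recurrence (1 ℕ.+ n) 0) ⟨
  w (4 ℕ.+ n) 1 ℕ.+ w (3 ℕ.+ n) 0 ∎
  where
  open ≡-Reasoning

theorem2p3 : (n : ℕ) → 5 ≤ n →
    + (w n 1) ≡ + (w (n ∸ 2) 1) + + (w (n ∸ 3) 0) - 1ℤ
theorem2p3 (suc (suc (suc (suc (suc n))))) (s≤s (s≤s (s≤s (s≤s (s≤s _))))) =
  -- On the left, `+ suc m - 1ℤ` computes to `+ m`.
  cong (λ m → + m - 1ℤ) (w-one-cell n)
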